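{- Let $G:\Sigma^{\mathbb{Z}}\to\Sigma^{\mathbb{Z}}$ be a reversible cellular automaton over a finite alphabet $\Sigma$, with block neighborhood $\mathcal{BN}\subseteq\mathbb{Z}$. For each cell $i\in\mathbb{Z}$ let $K_i=(G^{ -1}\times\mathrm{id})\circ S_i\circ(G\times\mathrm{id})$ be its reversible update at $i$. Consider the function $G\times G^{ -1}$ from $\mathcal{C}_\Sigma^2$ to $\mathcal{C}_\Sigma^2$, where $\mathcal{C}_\Sigma=\Sigma^{\mathbb{Z}}$. Then $$G\times G^{ -1}=S\circ\prod_{i}K_i,\qquad\text{with}\qquad \mathrm{Loc}(K_0)=\bigl(\{0\}\times\mathcal{BN}\bigr)\cup\{(1,0)\}.$$
   Context: A reversible cellular automaton (RCA) over a finite alphabet $\Sigma$ is a bijection $G$ of the configuration space $\mathcal{C}_\Sigma=\Sigma^{\mathbb{Z}}$ that commutes with all translations and is causal (there is a finite $\mathcal{N}\subset\mathbb{Z}$ such that $G(c)_0$ depends only on $c|_{\mathcal{N}}$), and whose inverse $G^{ -1}$ has the same properties. Two-layer configurations: $\mathcal{C}_{\Sigma^2}\simeq\mathcal{C}_\Sigma\times\mathcal{C}_\Sigma\simeq\Sigma^{\{0,1\}\times\mathbb{Z}}$. A configuration is a pair $(c,e)$, where $c$ is the first component (subcells $(0,j)$, $j\in\mathbb{Z}$) and $e$ is the second component (subcells $(1,j)$). In particular, $(1,0)$ denotes the subcell of the second component at cell $0$. For each cell $i$, $S_i$ is the map on $\mathcal{C}_{\Sigma^2}$ that exchanges the contents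 of subcells $(0,i)$ and $(1,i)$ and leaves all other subcells unchanged. $S=\prod_i S_i$ is the global swap $(c,e)\mapsto(e,c)$. Localization: let $X$ be a set of (sub)cells and $f$ a bijection of $\Sigma^X$. For $Y\subseteq X$, $f$ is localized upon $Y$ if $f=f_Y\times\mathrm{id}_{X\setminus Y}$ for some bijection $f_Y$ of $\Sigma^Y$ (identifying $\Sigma^X=\Sigma^Y\times\Sigma^{X\setminus Y}$). $\mathrm{Loc}(f)$ denotes the smallest (for inclusion) $Y\subseteq X$ upon which $f$ is localized. Semilocalizability: a bijection $F:A\times B\to C\times D$ is semilocalizable (with respect to these decompositions) if there are a set $E$ and bijections $g:A\to C\times E$ and $\tilde h:E\times B\to D$ such that $F=(\mathrm{id}_C\times\tilde h)\circ(g\times\mathrm{id}_B)$. Block neighborhood: $\mathcal{BN}$ is the smallest subset of $\mathbb{Z}$ such that $G$, viewed as a bijection $\Sigma^{\mathcal{BN}}\times\Sigma^{\mathbb{Z}\setminus\mathcal{BN}}\to\Sigma^{\{0\}}\times\Sigma^{\mathbb{Z}\setminus\{0\}}$, is semilocalizable. It is known that this smallest set exists and is finite. Infinite product: the maps $K_i$ commute pairwise, each is localized upon a finite set of subcells, and for any given subcell only finitely many $K_i$ act on it. Hence $\prod_i K_i$ is well-defined as a circuit of finite depth: its value at a configuration $w$ and subcell $x$ is the common value of $\bigl(\prod_{i\in I}K_i\bigr)(w)_x$ for all sufficiently large finite index sets $I$. The product $\prod_i S_i$ is understood in the same way. -}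

module Defs where

open import Data.Bool using (Bool; true; false; T; not; if_then_else_; _∧_; _∨_)
open import Data.Empty using (⊥-elim)
open import Data.Fin as Fin using (Fin; opposite)
open import Data.Fin.Patterns using (0F; 1F)
open import Data.Fin.Properties using (opposite-involutive)
open import Data.Integer using (ℤ; 0ℤ; _+_; _≟_)
open import Data.List using (List; []; _∷_; [_]; foldr)
open import Data.List.Membership.Propositional using (_∈_; _∉_)
open import Data.List.Relation.Binary.Subset.Propositional using (_⊆_)
open import Data.List.Relation.Unary.All using (lookup)
open import Data.List.Relation.Unary.AllPairs using (_∷_)
open import Data.List.Relation.Unary.Any using (here; there)
open import Data.List.Relation.Unary.Unique.Propositional using (Unique)
open import Data.Product using (∃; _×_; _,_; proj₁; proj₂)
open import Data.Product.Function.NonDependent.Setoid using (_×-inverse_)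
open import Data.Product.Properties using (≡-dec)
open import Data.Product.Relation.Binary.Pointwise.NonDependent using (_×ₛ_)
open import Function.Bundles using (Inverse)
open import Function.Construct.Identity using () renaming (inverse to idₛ)
import Function.Construct.Composition as Composition
import Function.Construct.Symmetry as Symmetry
open import Level using (Level; 0ℓ)
open import Relation.Binary.Bundles using (Setoid)
open import Relation.Binary.Definitions using (DecidableEquality)
open import Relation.Binary.PropositionalEquality
  using (_≡_; refl; trans; cong; _→-setoid_)
open import Relation.Nullary using (yes; no; does)

open Inverse using (to; from)

private
  variable
    A X : Set

infixr 9 _⊚_
_⊚_ : {R S T : Setoid 0ℓ 0ℓ} → Inverse S T → Inverse R S → Inverse R T
g ⊚ f = Composition.inverse f g

infix 11 _⁻¹
_⁻¹ : {R S : Setoid 0ℓ 0ℓ} → Inverse R S → Inverse S R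
f ⁻¹ = Symmetry.inverse f

infix 4 _≈ᵢ_
_≈ᵢ_ : {R S : Setoid 0ℓ 0ℓ} → Inverse R S → Inverse R S → Set
_≈ᵢ_ {R} {S} f g = ∀ x → Setoid._≈_ S (to f x) (to g x)

-- Subsets are Bool-valued because identifying Σ^X with Σ^Y × Σ^(X∖Y)
-- requires membership in Y to be decidable.
Subset : Set → Set
Subset X = X → Bool

∁ : Subset X → Subset X
∁ Y x = not (Y x)

infixr 6 _∪_
_∪_ : Subset X → Subset X → Subset X
(Y ∪ Z) x = Y x ∨ Z x

infixr 7 _⊗_
_⊗_ : {X X′ : Set} → Subset X → Subset X′ → Subset (X × X′)
(Y ⊗ Z) (x , x′) = Y x ∧ Z x′

singleton : DecidableEquality X → X → Subset X
singleton _≟ₓ_ x y = does (y ≟ₓ x)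

El : Subset X → Set
El Y = ∃ λ x → T (Y x)

IsSmallest : {ℓ : Level} → (Subset X → Set ℓ) → Subset X → Set ℓ
IsSmallest P Y = P Y × (∀ Z → P Z → ∀ x → T (Y x) → T (Z x))

infix 8 _^ₛ_
_^ₛ_ : Set → Set → Setoid 0ℓ 0ℓ
A ^ₛ X = X →-setoid A

pick : (b : Bool) → (T b → A) → (T (not b) → A) → A
pick true  y n = y _
pick false y n = n _

pick-η : ∀ b (a : A) → pick b (λ _ → a) (λ _ → a) ≡ a
pick-η true  a = refl
pick-η false a = refl

pick-T : ∀ b (y : T b → A) n t → pick b y n ≡ y t
pick-T true y n t = refl

pick-¬T : ∀ b (y : T b → A) n t → pick b y n ≡ n t
pick-¬T false y n t = refl

pick-cong : ∀ b {y y′ : T b → A} {n n′ : T (not b) → A} →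
            (∀ t → y t ≡ y′ t) → (∀ t → n t ≡ n′ t) → pick b y n ≡ pick b y′ n′
pick-cong true  p q = p _
pick-cong false p q = q _

-- The identification Σ^X ≃ Σ^Y × Σ^(X∖Y).
split : (Y : Subset X) → Inverse (A ^ₛ X) (A ^ₛ El Y ×ₛ A ^ₛ El (∁ Y))
split Y = record
  { to        = λ c → (λ (x , _) → c x) , (λ (x , _) → c x)
  ; from      = λ (a , b) x → pick (Y x) (λ t → a (x , t)) (λ t → b (x , t))
  ; to-cong   = λ p → (λ (x , _) → p x) , (λ (x , _) → p x)
  ; from-cong = λ (p , q) x → pick-cong (Y x) (λ t → p (x , t)) (λ t → q (x , t))
  ; inverse   =
      (λ p → (λ (x , t) → trans (p x) (pick-T (Y x) _ _ t))
           , (λ (x , t) → trans (p x) (pick-¬T (Y x) _ _ t)))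
    , (λ (p , q) x → trans (pick-cong (Y x) (λ t → p (x , t)) (λ t → q (x , t)))
                           (pick-η (Y x) _))
  }

LocalizedUpon : Inverse (A ^ₛ X) (A ^ₛ X) → Subset X → Set
LocalizedUpon {A} f Y =
  ∃ λ (f-Y : Inverse (A ^ₛ El Y) (A ^ₛ El Y)) →
    split Y ⊚ f ≈ᵢ (f-Y ×-inverse idₛ (A ^ₛ El (∁ Y))) ⊚ split Y

-- Loc(f) = Y
IsLoc : Inverse (A ^ₛ X) (A ^ₛ X) → Subset X → Set
IsLoc f = IsSmallest (LocalizedUpon f)

assoc : (R S U : Setoid 0ℓ 0ℓ) → Inverse ((R ×ₛ S) ×ₛ U) (R ×ₛ (S ×ₛ U))
assoc R S U = record
  { to        = λ ((r , s) , u) → r , (s , u)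
  ; from      = λ (r , (s , u)) → (r , s) , u
  ; to-cong   = λ ((p , q) , t) → p , (q , t)
  ; from-cong = λ (p , (q , t)) → (p , q) , t
  ; inverse   = (λ ((p , q) , t) → p , (q , t)) , (λ (p , (q , t)) → (p , q) , t)
  }

Semilocalizable : {R S U V : Setoid 0ℓ 0ℓ} → Inverse (R ×ₛ S) (U ×ₛ V) → Set₁
Semilocalizable {R} {S} {U} {V} F =
  ∃ λ (E : Setoid 0ℓ 0ℓ) →
  ∃ λ (g : Inverse R (U ×ₛ E)) →
  ∃ λ (h : Inverse (E ×ₛ S) V) →
    F ≈ᵢ (idₛ U ×-inverse h) ⊚ assoc U E S ⊚ (g ×-inverse idₛ S)

Conf : Set → Setoid 0ℓ 0ℓ
Conf A = A ^ₛ ℤ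

translate : ℤ → (ℤ → A) → (ℤ → A)
translate k c j = c (j + k)

CommutesWithTranslations : ((ℤ → A) → (ℤ → A)) → Set
CommutesWithTranslations F = ∀ k c j → F (translate k c) j ≡ translate k (F c) j

Causal : ((ℤ → A) → (ℤ → A)) → Set
Causal F = ∃ λ (N : List ℤ) →
  ∀ c c′ → (∀ j → j ∈ N → c j ≡ c′ j) → F c 0ℤ ≡ F c′ 0ℤ

record IsRCA (G : Inverse (Conf A) (Conf A)) : Set where
  field
    to-commutes   : CommutesWithTranslations (to G)
    to-causal     : Causal (to G)
    from-commutes : CommutesWithTranslations (from G)
    from-causal   : Causal (from G)

IsBlockNeighborhood : Inverse (Conf A) (Conf A) → Subset ℤ → Set₁
IsBlockNeighborhood G =
  IsSmallest λ Y → Semilocalizable (split (singleton _≟_ 0ℤ) ⊚ G ⊚ split Y ⁻¹)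

-- (0F , j) is the subcell at j of the first component, (1F , j) of the second.
Subcell : Set
Subcell = Fin 2 × ℤ

_≟ₛ_ : DecidableEquality Subcell
_≟ₛ_ = ≡-dec Fin._≟_ _≟_

Conf² : Set → Setoid 0ℓ 0ℓ
Conf² A = A ^ₛ Subcell

layers : Inverse (Conf² A) (Conf A ×ₛ Conf A)
layers = record
  { to        = λ w → (λ j → w (0F , j)) , (λ j → w (1F , j))
  ; from      = λ { (c , e) (0F , j) → c j ; (c , e) (1F , j) → e j }
  ; to-cong   = λ p → (λ j → p (0F , j)) , (λ j → p (1F , j))
  ; from-cong = λ { (p , q) (0F , j) → p j ; (p , q) (1F , j) → q j }
  ; inverse   = (λ p → (λ j → p (0F , j)) , (λ j → p (1F , j)))
              , (λ { (p , q) (0F , j) → p j ; (p , q) (1F , j) → q j })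
  }

infixr 10 _⊠_
_⊠_ : Inverse (Conf A) (Conf A) → Inverse (Conf A) (Conf A) → Inverse (Conf² A) (Conf² A)
F ⊠ H = layers ⁻¹ ⊚ (F ×-inverse H) ⊚ layers

involution : (f : (X → A) → (X → A)) →
             (∀ {v w} → (∀ x → v x ≡ w x) → ∀ x → f v x ≡ f w x) →
             (∀ w x → f (f w) x ≡ w x) → Inverse (A ^ₛ X) (A ^ₛ X)
involution f f-cong f-inv = record
  { to = f ; from = f ; to-cong = f-cong ; from-cong = f-cong
  ; inverse = (λ p x → trans (f-cong p x) (f-inv _ x))
            , (λ p x → trans (f-cong p x) (f-inv _ x)) }

swapAt : ℤ → Inverse (Conf² A) (Conf² A)
swapAt {A} i = involution f f-cong f-inv
  where
  f : (Subcell → A) → (Subcell → A)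
  f w (l , j) = if does (j ≟ i) then w (opposite l , j) else w (l , j)

  f-cong : ∀ {v w} → (∀ x → v x ≡ w x) → ∀ x → f v x ≡ f w x
  f-cong p (l , j) with j ≟ i
  ... | yes _ = p (opposite l , j)
  ... | no  _ = p (l , j)

  f-inv : ∀ w x → f (f w) x ≡ w x
  f-inv w (l , j) with j ≟ i
  ... | yes _ = cong (λ m → w (m , j)) (opposite-involutive l)
  ... | no  _ = refl

swap : Inverse (Conf² A) (Conf² A)
swap = involution
  (λ w (l , j) → w (opposite l , j))
  (λ p (l , j) → p (opposite l , j))
  (λ w (l , j) → cong (λ m → w (m , j)) (opposite-involutive l))

finiteProduct : (ℤ → Inverse (A ^ₛ X) (A ^ₛ X)) → List ℤ → Inverse (A ^ₛ X) (A ^ₛ X)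
finiteProduct {A} {X} K = foldr (λ i F → K i ⊚ F) (idₛ (A ^ₛ X))

-- P = ∏ᵢ Kᵢ.  A finite index set is a repetition-free list; quantifying over
-- all of them also makes the value independent of the order of the factors.
IsProduct : (ℤ → Inverse (A ^ₛ X) (A ^ₛ X)) → Inverse (A ^ₛ X) (A ^ₛ X) → Set
IsProduct K P = ∀ w x → ∃ λ (I₀ : List ℤ) →
  ∀ I → Unique I → I₀ ⊆ I → to (finiteProduct K I) w x ≡ to P w x

swap-isProduct : IsProduct (swapAt {A}) swap
swap-isProduct {A} w (l , j) = [ j ] , λ I u I₀⊆I → inside I u (I₀⊆I (here refl)) l
  where
  outside : ∀ I → j ∉ I → ∀ m → to (finiteProduct swapAt I) w (m , j) ≡ w (m , j)
  outside []      _   m = refl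
  outside (i ∷ I) j∉I m with j ≟ i
  ... | yes j≡i = ⊥-elim (j∉I (here j≡i))
  ... | no  _   = outside I (λ j∈I → j∉I (there j∈I)) m

  inside : ∀ I → Unique I → j ∈ I → ∀ m →
           to (finiteProduct swapAt I) w (m , j) ≡ w (opposite m , j)
  inside (i ∷ I) (i∉I ∷ u) j∈iI m with j ≟ i
  ... | yes refl = outside I (λ j∈I → lookup i∉I j∈I refl) (opposite m)
  inside (i ∷ I) (i∉I ∷ u) (here j≡i)  m | no j≢i = ⊥-elim (j≢i j≡i)
  inside (i ∷ I) (i∉I ∷ u) (there j∈I) m | no _   = inside I u j∈I m

reversibleUpdate : Inverse (Conf A) (Conf A) → ℤ → Inverse (Conf² A) (Conf² A)
reversibleUpdate {A} G i =
  (G ⁻¹ ⊠ idₛ (Conf A)) ⊚ swapAt i ⊚ (G ⊠ idₛ (Conf A))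

{-# OPTIONS --safe #-}

-- A finite product of the Kᵢ is the conjugate by G × id of the corresponding
-- partial swap, and causality of G⁻¹ makes each subcell of it stabilize.
--
-- The localization reduces to the map c ↦ G⁻¹(G c with the cell 0 overwritten by s).
-- If G = (id × h)(g × id), with g c = (x , ε) on the block neighborhood, this
-- map only replaces g⁻¹(x , ε) by g⁻¹(s , ε), so K₀ acts on BN and (1,0) alone.
-- Conversely, if K₀ is localized upon Z, these overwriting maps yield a
-- semilocalization of G on the first layer of Z: E consists of the patterns on
-- that layer, identified when they produce the same output off the cell 0.
module Submission where

open import Defs
open import Data.Bool using (true; false; T; not; if_then_else_)
open import Data.Bool.Properties using (∨-identityʳ)
open import Data.Fin as Fin using (Fin)
open import Data.Fin.Patterns using (0F; 1F)
open import Data.Fin.Properties using (0≢1+n)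
open import Data.Integer using (ℤ; 0ℤ; _+_; _≟_)
open import Data.Integer.Properties using (+-identityˡ)
open import Data.List using ([]; _∷_; map)
open import Data.List.Membership.Propositional using (_∈_)
open import Data.List.Membership.Propositional.Properties using (∈-map⁺)
open import Data.List.Relation.Unary.Any using (here)
open import Data.Nat using (ℕ; _≤_; s≤s)
open import Data.Product using (∃; _×_; _,_; proj₁; proj₂)
open import Data.Product.Relation.Binary.Pointwise.NonDependent using (_×ₛ_)
open import Function using (_∘_)
open import Function.Bundles using (Inverse; _↔_)
open import Function.Construct.Identity using () renaming (inverse to idₛ)
import Function.Consequences.Setoid as Consequences
open import Level using (0ℓ)
open import Relation.Binary.Bundles using (Setoid)
open import Relation.Binary.PropositionalEquality
  using (_≡_; _≢_; refl; sym; trans; cong; subst)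
open import Relation.Nullary using (yes)

open Inverse using (to; from; to-cong; from-cong; strictlyInverseˡ; strictlyInverseʳ)

private
  variable
    A X X′ : Set

pick-if : ∀ b {x y : A} → pick b (λ _ → x) (λ _ → y) ≡ (if b then x else y)
pick-if true  = refl
pick-if false = refl

if-T : ∀ b {x y : A} → T b → (if b then x else y) ≡ x
if-T true _ = refl

if-¬T : ∀ b {x y : A} → T (not b) → (if b then x else y) ≡ y
if-¬T false _ = refl

mkInverse : {R S : Setoid 0ℓ 0ℓ} →
            let open Setoid R renaming (Carrier to |R|; _≈_ to _≈ʳ_)
                open Setoid S renaming (Carrier to |S|; _≈_ to _≈ˢ_) in
            (f : |R| → |S|) (f⁻¹ : |S| → |R|) →
            (∀ {x y} → x ≈ʳ y → f x ≈ˢ f y) → (∀ {x y} → x ≈ˢ y → f⁻¹ x ≈ʳ f⁻¹ y) →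
            (∀ y → f (f⁻¹ y) ≈ˢ y) → (∀ x → f⁻¹ (f x) ≈ʳ x) → Inverse R S
mkInverse {R} {S} f f⁻¹ f-cong f⁻¹-cong invˡ invʳ = record
  { to = f ; from = f⁻¹ ; to-cong = f-cong ; from-cong = f⁻¹-cong
  ; inverse = strictlyInverseˡ⇒inverseˡ f-cong invˡ , strictlyInverseʳ⇒inverseʳ f⁻¹-cong invʳ }
  where open Consequences R S

-- Restriction and gluing of patterns.

restrict : (Y : Subset X) → (X → A) → El Y → A
restrict Y c (x , _) = c x

glue : (Y : Subset X) → (El Y → A) → (El (∁ Y) → A) → X → A
glue Y a b = from (split Y) (a , b)

Agree : (Y : Subset X) → (X → A) → (X → A) → Set
Agree Y c c′ = ∀ (x : El Y) → restrict Y c x ≡ restrict Y c′ x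

glue-inside : (Y : Subset X) (a : El Y → A) (b : El (∁ Y) → A) →
              ∀ x → restrict Y (glue Y a b) x ≡ a x
glue-inside Y a b = proj₁ (strictlyInverseˡ (split Y) (a , b))

glue-outside : (Y : Subset X) (a : El Y → A) (b : El (∁ Y) → A) →
               ∀ x → restrict (∁ Y) (glue Y a b) x ≡ b x
glue-outside Y a b = proj₂ (strictlyInverseˡ (split Y) (a , b))

glue-cong : (Y : Subset X) {a a′ : El Y → A} {b b′ : El (∁ Y) → A} →
            (∀ x → a x ≡ a′ x) → (∀ x → b x ≡ b′ x) → ∀ x → glue Y a b x ≡ glue Y a′ b′ x
glue-cong Y p q = from-cong (split Y) (p , q)

glue-unique : (Y : Subset X) {a : El Y → A} {b : El (∁ Y) → A} {c : X → A} →
              (∀ x → a x ≡ restrict Y c x) → (∀ x → b x ≡ restrict (∁ Y) c x) →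
              ∀ x → glue Y a b x ≡ c x
glue-unique Y {c = c} p q x =
  trans (glue-cong Y p q x) (strictlyInverseʳ (split Y) c x)

-- A pointwise criterion for localization.

Preserves : Subset X → ((X → A) → (X → A)) → Set
Preserves Y f = ∀ w → Agree Y (f w) w

Determines : Subset X → ((X → A) → (X → A)) → Set
Determines Y f = ∀ {w w′} → Agree Y w w′ → Agree Y (f w) (f w′)

module _ (f : Inverse (A ^ₛ X) (A ^ₛ X)) (Y : Subset X) where

  localized⇒preserves : LocalizedUpon f Y → Preserves (∁ Y) (to f)
  localized⇒preserves (_ , eq) w = proj₂ (eq w)

  localized⇒determines : LocalizedUpon f Y → Determines Y (to f)
  localized⇒determines (f-Y , eq) {w} {w′} p x =
    trans (proj₁ (eq w) x) (trans (to-cong f-Y p x) (sym (proj₁ (eq w′) x)))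

  module _ (pres : Preserves (∁ Y) (to f)) (det : Determines Y (to f)) where

    -- The glued `u` is the preimage of `w′`: on `Y`, `det` compares `to f u` with
    -- `to f (from f w)`, which is `w`; off `Y`, `f` leaves `u`, and so `w′`, in place. Hence
    -- `from f w′` is `u`, which is `from f w` on `Y`.
    determines⁻¹ : Determines Y (from f)
    determines⁻¹ {w} {w′} p (x , t) =
      trans (sym (glue-inside Y a b (x , t))) (trans (sym (strictlyInverseʳ f u x))
        (from-cong f fu≈w′ x))
      where
      a = restrict Y (from f w)
      b = restrict (∁ Y) w′

      u : X → A
      u = glue Y a b

      fu≈w′ : ∀ y → to f u y ≡ w′ y
      fu≈w′ y = trans (sym (strictlyInverseʳ (split Y) (to f u) y)) (glue-unique Y
        (λ z → trans (det (glue-inside Y a b) z) (trans (strictlyInverseˡ f w (proj₁ z)) (p z)))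
        (λ z → trans (pres u z) (glue-outside Y a b z)) y)

    -- A pattern on `Y` must be extended before `f` can act on it. The filler `a₀` is arbitrary:
    -- neither `f` nor its inverse lets cells off `Y` influence those in `Y`.
    preserves∧determines⇒localized : A → LocalizedUpon f Y
    preserves∧determines⇒localized a₀ = f-Y , λ w →
      (λ x → det (λ y → sym (glue-inside Y (restrict Y w) _ y)) x) , pres w
      where
      extend : (El Y → A) → X → A
      extend a = glue Y a (λ _ → a₀)

      f-Y : Inverse (A ^ₛ El Y) (A ^ₛ El Y)
      f-Y = mkInverse
        (λ a → restrict Y (to f (extend a)))
        (λ a → restrict Y (from f (extend a)))
        (λ p (x , _) → to-cong f (glue-cong Y p (λ _ → refl)) x)
        (λ p (x , _) → from-cong f (glue-cong Y p (λ _ → refl)) x)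
        (λ a x → trans (det (glue-inside Y _ _) x)
                       (trans (strictlyInverseˡ f _ (proj₁ x)) (glue-inside Y a _ x)))
        (λ a x → trans (determines⁻¹ (glue-inside Y _ _) x)
                       (trans (strictlyInverseʳ f _ (proj₁ x)) (glue-inside Y a _ x)))

-- Overwriting outputs, and semilocalizability.

module _ (G : Inverse (A ^ₛ X) (A ^ₛ X′)) (V : Subset X′) where

  overwrite : (El V → A) → (X → A) → X → A
  overwrite u c = from G (glue V u (restrict (∁ V) (to G c)))

  overwrite-cong : ∀ {u u′ c c′} → (∀ x → u x ≡ u′ x) → Agree (∁ V) (to G c) (to G c′) →
                   ∀ x → overwrite u c x ≡ overwrite u′ c′ x
  overwrite-cong p q = from-cong G (glue-cong V p q)

  to-overwrite : ∀ u c x → to G (overwrite u c) x ≡ glue V u (restrict (∁ V) (to G c)) x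
  to-overwrite u c = strictlyInverseˡ G _

  to-overwrite-inside : ∀ u c x → restrict V (to G (overwrite u c)) x ≡ u x
  to-overwrite-inside u c x =
    trans (to-overwrite u c (proj₁ x)) (glue-inside V u (restrict (∁ V) (to G c)) x)

  to-overwrite-outside : ∀ u c → Agree (∁ V) (to G (overwrite u c)) (to G c)
  to-overwrite-outside u c x =
    trans (to-overwrite u c (proj₁ x)) (glue-outside V u (restrict (∁ V) (to G c)) x)

  overwrite-self : ∀ c x → overwrite (restrict V (to G c)) c x ≡ c x
  overwrite-self c x =
    trans (from-cong G (strictlyInverseʳ (split V) (to G c)) x) (strictlyInverseʳ G c x)

  -- The middle term between semilocalizability and the localization of `K₀`: `preserves` and
  -- `determines` govern the first layer for a fixed incoming `u`, and `output` governs what the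
  -- swap sends to the second layer.
  record OverwritesWithin (Y : Subset X) : Set where
    field
      output     : ∀ {c c′} → Agree Y c c′ → Agree V (to G c) (to G c′)
      preserves  : ∀ u → Preserves (∁ Y) (overwrite u)
      determines : ∀ u → Determines Y (overwrite u)

  module _ (Y : Subset X) where

    semilocalizable⇒overwritesWithin :
      Semilocalizable (split V ⊚ G ⊚ split Y ⁻¹) → OverwritesWithin Y
    semilocalizable⇒overwritesWithin (E , g , h , eq) = record
      { output     = λ {c} {c′} p x → trans (out c x)
                       (trans (proj₁ (to-cong g p) x) (sym (out c′ x)))
      ; preserves  = λ u c x → trans (overwrite≈ u c (proj₁ x))
                       (glue-outside Y (inner u c) (restrict (∁ Y) c) x)
      ; determines = λ u {c} {c′} p x → trans (overwrite-inside u c x)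
                       (trans (from-cong g ((λ _ → refl) , proj₂ (to-cong g p)) x)
                              (sym (overwrite-inside u c′ x)))
      }
      where
      ε : (X → A) → Setoid.Carrier E
      ε c = proj₂ (to g (restrict Y c))

      inner : (El V → A) → (X → A) → El Y → A
      inner u c = from g (u , ε c)

      out : ∀ c x → restrict V (to G c) x ≡ proj₁ (to g (restrict Y c)) x
      out c x = trans (sym (to-cong G (strictlyInverseʳ (split Y) c) (proj₁ x)))
                      (proj₁ (eq (to (split Y) c)) x)

      rest : ∀ c x → restrict (∁ V) (to G c) x ≡ to h (ε c , restrict (∁ Y) c) x
      rest c x = trans (sym (to-cong G (strictlyInverseʳ (split Y) c) (proj₁ x)))
                       (proj₂ (eq (to (split Y) c)) x)

      -- The right-hand side has the required output: `g` yields `u` on `V`, and off `V` the map `h`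
      -- reads only `ε c` and the cells off `Y`, which are the same as for `c`.
      overwrite≈ : ∀ u c x →
        overwrite u c x ≡ glue Y (inner u c) (restrict (∁ Y) c) x
      overwrite≈ u c x = trans (from-cong G (glue-unique V inside outside) x) (strictlyInverseʳ G _ x)
        where
        d = glue Y (inner u c) (restrict (∁ Y) c)

        inside : ∀ y → u y ≡ restrict V (to G d) y
        inside y = sym (trans (proj₁ (eq _) y) (proj₁ (strictlyInverseˡ g (u , ε c)) y))

        outside : Agree (∁ V) (to G c) (to G d)
        outside y = trans (rest c y) (sym (trans (proj₂ (eq _) y)
          (to-cong h (proj₂ (strictlyInverseˡ g (u , ε c)) , λ _ → refl) y)))

      overwrite-inside : ∀ u c x → restrict Y (overwrite u c) x ≡ inner u c x
      overwrite-inside u c x =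
        trans (overwrite≈ u c (proj₁ x)) (glue-inside Y (inner u c) (restrict (∁ Y) c) x)

    overwritesWithin⇒semilocalizable :
      A → OverwritesWithin Y → Semilocalizable (split V ⊚ G ⊚ split Y ⁻¹)
    overwritesWithin⇒semilocalizable a₀ ow = E , g , h , λ (a , b) →
      -- `g` computes the output on `V` over the background `a₀`; `output` transfers it to `b`. Off
      -- `V`, `h` receives the representative `a` itself.
      (λ x → output (λ y → trans (glue-inside Y a b y) (sym (glue-inside Y a _ y))) x) , λ x → refl
      where
      open OverwritesWithin ow

      -- The quotient is expressed by the setoid equality. Quantifying over every background `b` is
      -- what lets `h` respect it.
      E : Setoid 0ℓ 0ℓ
      E = record
        { Carrier = El Y → A
        ; _≈_ = λ a a′ → ∀ b → Agree (∁ V) (to G (glue Y a b)) (to G (glue Y a′ b))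
        ; isEquivalence = record
          { refl  = λ b x → refl
          ; sym   = λ p b x → sym (p b x)
          ; trans = λ p q b x → trans (p b x) (q b x)
          }
        }

      -- The new pattern on `Y` is independent of the background by `determines`, and the background
      -- survives by `preserves`, so `b` can be exchanged for `b′`.
      glue-overwrite : ∀ u a b b′ x →
        glue Y (restrict Y (overwrite u (glue Y a b))) b′ x ≡ overwrite u (glue Y a b′) x
      glue-overwrite u a b b′ = glue-unique Y
        (determines u (λ y → trans (glue-inside Y a b y) (sym (glue-inside Y a b′ y))))
        (λ y → sym (trans (preserves u _ y) (glue-outside Y a b′ y)))

      -- Overwriting on `V` never leaves the class in `E`; this makes both `g` and `h` invertible.
      overwrite-∼ : ∀ u a b → Setoid._≈_ E (restrict Y (overwrite u (glue Y a b))) a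
      overwrite-∼ u a b b′ x =
        trans (to-cong G (glue-overwrite u a b b′) (proj₁ x)) (to-overwrite-outside u _ x)

      extend : (El Y → A) → X → A
      extend a = glue Y a (λ _ → a₀)

      g : Inverse (A ^ₛ El Y) (A ^ₛ El V ×ₛ E)
      g = mkInverse
        (λ a → restrict V (to G (extend a)) , a)
        (λ (u , a) → restrict Y (overwrite u (extend a)))
        (λ p → (λ x → to-cong G (glue-cong Y p (λ _ → refl)) (proj₁ x))
             , (λ b x → to-cong G (glue-cong Y p (λ _ → refl)) (proj₁ x)))
        -- `overwrite` sees the configuration only through its output off `V`, so equivalent
        -- patterns give equal results.
        (λ (p , q) x → overwrite-cong p (q _) (proj₁ x))
        (λ (u , a) → (λ x → trans (to-cong G (glue-overwrite u a _ _) (proj₁ x))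
                                  (to-overwrite-inside u _ x))
                   , overwrite-∼ u a _)
        (λ a x → trans (overwrite-self (extend a) (proj₁ x)) (glue-inside Y a _ x))

      fill : (El (∁ V) → A) → X → A
      fill d = from G (glue V (λ _ → a₀) d)

      h : Inverse (E ×ₛ A ^ₛ El (∁ Y)) (A ^ₛ El (∁ V))
      h = mkInverse
        (λ (a , b) → restrict (∁ V) (to G (glue Y a b)))
        (λ d → to (split Y) (fill d))
        (λ (p , q) x → trans (p _ x) (to-cong G (glue-cong Y (λ _ → refl) q) (proj₁ x)))
        (λ p → (λ b x → to-cong G (glue-cong Y
                  (λ y → fill-cong p (proj₁ y)) (λ _ → refl)) (proj₁ x))
             , (λ x → fill-cong p (proj₁ x)))
        (λ d x → trans (to-cong G (strictlyInverseʳ (split Y) (fill d)) (proj₁ x))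
                       (trans (strictlyInverseˡ G _ (proj₁ x)) (glue-outside V _ d x)))
        -- Filling `V` with `a₀` after erasing the output there is exactly `overwrite` by the
        -- constant `a₀`.
        (λ (a , b) → overwrite-∼ (λ _ → a₀) a b
                   , (λ x → trans (preserves _ _ x) (glue-outside Y a b x)))
        where
        fill-cong : ∀ {d d′} → (∀ x → d x ≡ d′ x) → ∀ x → fill d x ≡ fill d′ x
        fill-cong p = from-cong G (glue-cong V (λ _ → refl) p)

-- Products of conjugates and their stabilization.

finiteProduct-conjugate :
  (f : Inverse (A ^ₛ X) (A ^ₛ X)) (K L : ℤ → Inverse (A ^ₛ X) (A ^ₛ X)) →
  (∀ i → L i ≈ᵢ f ⁻¹ ⊚ K i ⊚ f) →
  ∀ I → finiteProduct L I ≈ᵢ f ⁻¹ ⊚ finiteProduct K I ⊚ f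
finiteProduct-conjugate f K L eq []      w x = sym (strictlyInverseʳ f w x)
finiteProduct-conjugate f K L eq (i ∷ I) w x =
  trans (eq i _ x) (from-cong f (to-cong (K i) λ y →
    trans (to-cong f (finiteProduct-conjugate f K L eq I w) y) (strictlyInverseˡ f _ y)) x)

causal-at : {F : (ℤ → A) → (ℤ → A)} →
            CommutesWithTranslations F → (causal : Causal F) → ∀ j c c′ →
            (∀ k → k ∈ map (_+ j) (proj₁ causal) → c k ≡ c′ k) → F c j ≡ F c′ j
causal-at {F = F} comm (N , loc) j c c′ p =
  trans (shift c) (trans (loc _ _ λ k k∈N → p _ (∈-map⁺ (_+ j) k∈N)) (sym (shift c′)))
  where
  shift : ∀ d → F d j ≡ F (translate j d) 0ℤ
  shift d = trans (cong (F d) (sym (+-identityˡ j))) (sym (comm j d 0ℤ))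

module _ (G : Inverse (Conf A) (Conf A)) where

  -- Conjugating the full swap by `G × id` gives `(c , e) ↦ (G⁻¹ e , G c)`, which is the swap after
  -- `G × G⁻¹`.
  reversibleUpdate-isProduct :
    CommutesWithTranslations (from G) → Causal (from G) →
    IsProduct (reversibleUpdate G) (swap ⊚ (G ⊠ G ⁻¹))
  reversibleUpdate-isProduct comm causal w = λ where
      -- Every cell that `G⁻¹` reads for its value at `j` must already have been swapped; on the
      -- second layer the cell `j` alone suffices.
      (0F , j) → map (_+ j) (proj₁ causal) , λ I u I₀⊆I →
        trans (conjugate I (0F , j)) (causal-at {F = from G} comm causal j _ _ λ k k∈ →
          proj₂ (swap-isProduct w′ (0F , k)) I u λ { (here refl) → I₀⊆I k∈ })
      (1F , j) → proj₁ (swap-isProduct w′ (1F , j)) , λ I u I₀⊆I →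
        trans (conjugate I (1F , j)) (proj₂ (swap-isProduct w′ (1F , j)) I u I₀⊆I)
    where
    G×id = G ⊠ idₛ (Conf A)
    w′ = to G×id w

    conjugate : ∀ I x → to (finiteProduct (reversibleUpdate G) I) w x
                      ≡ from G×id (to (finiteProduct swapAt I) w′) x
    conjugate I = finiteProduct-conjugate G×id swapAt (reversibleUpdate G)
      (λ { i v (0F , j) → refl ; i v (1F , j) → refl }) I w

  -- Localization of the reversible update at the cell 0.

  private
    K = reversibleUpdate G 0ℤ

    V : Subset ℤ
    V = singleton _≟_ 0ℤ

  layer : Fin 2 → (Subcell → A) → ℤ → A
  layer l w j = w (l , j)

  -- The swap puts the content of `(1F , 0ℤ)` in place of the output of `G` at 0 before `G⁻¹` is
  -- applied.
  update-first : ∀ w j → to K w (0F , j) ≡ overwrite G V (restrict V (layer 1F w)) (layer 0F w) j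
  update-first w = from-cong G λ j → sym (pick-if (V j))

  module _ (Z : Subset Subcell) where

    -- `Z` is given through pointwise equations for its layers, since a union of Boolean subsets
    -- need not reduce to them.
    overwritesWithin⇒localized :
      A → {Y : Subset ℤ} → (∀ j → Z (0F , j) ≡ Y j) → (∀ j → Z (1F , j) ≡ V j) →
      OverwritesWithin G V Y → LocalizedUpon K Z
    overwritesWithin⇒localized a₀ {Y} Z₀ Z₁ ow = preserves∧determines⇒localized K Z
      (λ { w ((0F , j) , t) → trans (update-first w j) (preserves _ _ (j , subst (T ∘ not) (Z₀ j) t))
         ; w ((1F , j) , t) → if-¬T (V j) (subst (T ∘ not) (Z₁ j) t) })
      (λ { {w} {w′} p ((0F , j) , t) →
             trans (update-first w j) (trans (determines _ (first p) (j , subst T (Z₀ j) t))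
               (trans (overwrite-cong G V (λ (k , s) → p ((1F , k) , subst T (sym (Z₁ k)) s)) (λ _ → refl) j)
                 (sym (update-first w′ j))))
         ; {w} {w′} p ((1F , j) , t) → let s = subst T (Z₁ j) t in
             trans (if-T (V j) s) (trans (output (first p) (j , s))
               (sym (if-T (V j) s))) })
      a₀
      where
      open OverwritesWithin ow

      first : ∀ {w w′} → Agree Z w w′ → Agree Y (layer 0F w) (layer 0F w′)
      first p (j , t) = p ((0F , j) , subst T (sym (Z₀ j)) t)

    -- With `u` stored at `(1F , 0ℤ)`, the first layer of the update is `overwrite` by `u`. The
    -- update also writes the output of `G` at 0 into `(1F , 0ℤ)`, so membership of that subcell in
    -- `Z` yields `output`.
    localized⇒overwritesWithin :
      A → T (Z (1F , 0ℤ)) → LocalizedUpon K Z → OverwritesWithin G V (λ j → Z (0F , j))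
    localized⇒overwritesWithin a₀ z loc = record
      { output     = λ p (j , t) → output′ p j t
      ; preserves  = λ u c (j , t) → trans (overwrite≈ u c j) (pres (two c (ext u)) ((0F , j) , t))
      ; determines = λ u {c} {c′} p (j , t) →
          trans (overwrite≈ u c j) (trans (det (agree p (ext u)) ((0F , j) , t)) (sym (overwrite≈ u c′ j)))
      }
      where
      pres = localized⇒preserves K Z loc
      det : Determines Z (to K)
      det = localized⇒determines K Z loc

      two : (ℤ → A) → (ℤ → A) → Subcell → A
      two c e = from layers (c , e)

      ext : (El V → A) → ℤ → A
      ext u = glue V u (λ _ → a₀)

      agree : ∀ {c c′} → Agree (λ j → Z (0F , j)) c c′ → ∀ e → Agree Z (two c e) (two c′ e)
      agree p e ((0F , j) , t) = p (j , t)
      agree p e ((1F , j) , t) = refl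

      overwrite≈ : ∀ u c j → overwrite G V u c j ≡ to K (two c (ext u)) (0F , j)
      overwrite≈ u c j = sym (trans (update-first (two c (ext u)) j)
        (overwrite-cong G V (glue-inside V u _) (λ _ → refl) j))

      output′ : ∀ {c c′} → Agree (λ j → Z (0F , j)) c c′ → ∀ j → T (V j) → to G c j ≡ to G c′ j
      output′ p j t with j ≟ 0ℤ
      ... | yes refl = det (agree p (λ _ → a₀)) ((1F , 0ℤ) , z)

    -- Off `Z` the content of `(1F , 0ℤ)` would be preserved, yet its new value depends on the first
    -- layer only and cannot equal both `a` and `a′`.
    localized⇒second : {a a′ : A} → a ≢ a′ → LocalizedUpon K Z → T (Z (1F , 0ℤ))
    localized⇒second {a} {a′} a≢a′ loc with Z (1F , 0ℤ) in eq
    ... | true  = _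
    ... | false = a≢a′ (trans (sym (fixed a)) (fixed a′))
      where
      fixed : ∀ s → to G (λ _ → a) 0ℤ ≡ s
      fixed s = localized⇒preserves K Z loc (from layers ((λ _ → a) , (λ _ → s)))
                  ((1F , 0ℤ) , subst (T ∘ not) (sym eq) _)

-- The product formula and the exact localization.

distinct : {n : ℕ} → A ↔ Fin n → 2 ≤ n → ∃ λ (a : A) → ∃ λ a′ → a ≢ a′
distinct φ (s≤s (s≤s _)) = from φ 0F , from φ 1F , λ eq →
  0≢1+n (trans (sym (strictlyInverseˡ φ 0F)) (trans (cong (to φ) eq) (strictlyInverseˡ φ 1F)))

corollary1 : ∀ {A : Set} {n : ℕ} → A ↔ Fin n → 2 ≤ n →
    (G : Inverse (Conf A) (Conf A)) → IsRCA G →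
    (BN : Subset ℤ) → IsBlockNeighborhood G BN →
    (∃ λ P → IsProduct (reversibleUpdate G) P × (G ⊠ G ⁻¹ ≈ᵢ swap ⊚ P))
    × IsLoc (reversibleUpdate G 0ℤ)
    ((singleton Fin._≟_ 0F ⊗ BN) ∪ singleton _≟ₛ_ (1F , 0ℤ))
corollary1 {A} φ 2≤n G rca BN (semiloc , smallest) =
    (swap ⊚ (G ⊠ G ⁻¹) , reversibleUpdate-isProduct G from-commutes from-causal ,
      λ w (l , j) → sym (strictlyInverseˡ swap (to (G ⊠ G ⁻¹) w) (l , j)))
  , overwritesWithin⇒localized G _ a (λ j → ∨-identityʳ (BN j)) (λ j → refl)
      (semilocalizable⇒overwritesWithin G (singleton _≟_ 0ℤ) BN semiloc)
  , λ where
      -- The first layer of `Z` semilocalizes `G`, so minimality of `BN` places `BN` inside it.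
      Z loc (0F , j) t → smallest (λ k → Z (0F , k))
        (overwritesWithin⇒semilocalizable G _ _ a
          (localized⇒overwritesWithin G Z a (localized⇒second G Z a≢a′ loc) loc))
        j (subst T (∨-identityʳ (BN j)) t)
      Z loc (1F , j) t → second Z (localized⇒second G Z a≢a′ loc) j t
  where
  open IsRCA rca
  a = proj₁ (distinct φ 2≤n)
  a≢a′ = proj₂ (proj₂ (distinct φ 2≤n))

  second : ∀ (Z : Subset Subcell) → T (Z (1F , 0ℤ)) → ∀ j → T (singleton _≟_ 0ℤ j) → T (Z (1F , j))
  second Z z j t with j ≟ 0ℤ
  ... | yes refl = z
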